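{- There exist constants $c>0$ and $C>0$ such that for all sufficiently large $n$ there is a random matrix $\mathbf{A}$ taking values in $\{0,1\}^{n\times n}$ which is $k$-uniform for some $k\ge n^{c}$, and such that every possible value $A$ of $\mathbf{A}$ satisfies $C_\oplus(A)\le C n$.
   Context: A random matrix $\mathbf{A}\in\{0,1\}^{n\times n}$ is called $k$-uniform if for every choice of $k$ rows and $k$ columns, the entries of the corresponding $k\times k$ submatrix have joint (marginal) distribution uniform on $\{0,1\}^{k\times k}$. A circuit is a directed acyclic graph whose in-degree-zero vertices are input gates $x_1,\dots,x_n$ and whose other vertices are gates of unbounded fan-in; some gates are designated outputs $y_1,\dots,y_n$; its size is its number of wires. An XOR-circuit computes the boolean matrix $A=(a_{ij})$ if, with each gate computing the sum modulo 2 of its children, each output computes $y_i=\sum_j a_{ij}x_j$ over $\mathrm{GF}(2)$ as a formal linear form. $C_\oplus(A)$ is the minimum size of an XOR-circuit computing $A$. -}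

module Defs where

open import Data.Bool using (Bool; true; false; _xor_; not; if_then_else_)
open import Data.Nat using (ℕ; zero; suc; _+_; _*_; _^_; _≤_)
open import Data.Fin using (Fin; zero; suc)
open import Data.Fin.Properties using (_≟_)
open import Data.List using (List; []; _∷_; length; foldr; map; allFin)
open import Data.Bool using (_∧_)
open import Data.Sum using (_⊎_; inj₁; inj₂)
open import Data.Product using (Σ; _×_)
open import Relation.Nullary.Decidable using (does)
open import Relation.Binary.PropositionalEquality using (_≡_)
open import Function.Definitions using (Injective)

Matrix : ℕ → Set
Matrix n = Fin n → Fin n → Bool

-- Linear forms over GF(2) in variables x_1..x_n, given by coefficient vectors.
LinForm : ℕ → Set
LinForm n = Fin n → Bool

unitForm : ∀ {n} → Fin n → LinForm n
unitForm j x = does (j ≟ x)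

zeroForm : ∀ {n} → LinForm n
zeroForm _ = false

_⊕_ : ∀ {n} → LinForm n → LinForm n → LinForm n
(f ⊕ g) x = f x xor g x

sumForms : ∀ {n} → List (LinForm n) → LinForm n
sumForms = foldr _⊕_ zeroForm

-- XOR circuits.  A circuit on n inputs with m (non-input) gates is a
-- sequence of gates in topological order; each new gate lists its
-- children (wires into it), each being an input gate (inj₁ j) or an
-- earlier gate (inj₂ i).  In 'Gates n m', gate index 'zero' is the most
-- recently added gate.  Acyclicity is built in; fan-in is unbounded.

data Gates (n : ℕ) : ℕ → Set where
  []  : Gates n 0
  _▷_ : ∀ {m} → Gates n m → List (Fin n ⊎ Fin m) → Gates n (suc m)

Node : ℕ → ℕ → Set
Node n m = Fin n ⊎ Fin m

mutual
  gateValue : ∀ {n m} → Gates n m → Fin m → LinForm n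
  gateValue (gs ▷ cs) zero    = sumForms (childValues gs cs)
  gateValue (gs ▷ cs) (suc i) = gateValue gs i

  childValues : ∀ {n m} → Gates n m → List (Node n m) → List (LinForm n)
  childValues gs []       = []
  childValues gs (c ∷ cs) = nodeValue gs c ∷ childValues gs cs

  nodeValue : ∀ {n m} → Gates n m → Node n m → LinForm n
  nodeValue gs (inj₁ j) = unitForm j
  nodeValue gs (inj₂ i) = gateValue gs i

wires : ∀ {n m} → Gates n m → ℕ
wires []        = 0
wires (gs ▷ cs) = wires gs + length cs

record XorCircuit (n : ℕ) : Set where
  field
    numGates : ℕ
    gates    : Gates n numGates
    output   : Fin n → Node n numGates

  size : ℕ
  size = wires gates

open XorCircuit public

Computes : ∀ {n} → XorCircuit n → Matrix n → Set
Computes {n} Γ A = (i j : Fin n) → nodeValue (gates Γ) (output Γ i) j ≡ A i j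

-- C_⊕(A) ≤ b  (C_⊕ is the minimum size, so this is existence of a circuit).
XorComplexity≤ : ∀ {n} → Matrix n → ℕ → Set
XorComplexity≤ {n} A b = Σ (XorCircuit n) λ Γ → Computes Γ A × size Γ ≤ b

-- Random matrices with rational probabilities, represented as the uniform
-- distribution on a (nonempty) multiset, i.e. list, of matrices.

allᵇ : ∀ {A : Set} → (A → Bool) → List A → Bool
allᵇ p []       = true
allᵇ p (x ∷ xs) = p x ∧ allᵇ p xs

count : ∀ {A : Set} → (A → Bool) → List A → ℕ
count p []       = 0
count p (x ∷ xs) = if p x then suc (count p xs) else count p xs

matchesPattern : ∀ {n k} → (r c : Fin k → Fin n) → (Fin k → Fin k → Bool) → Matrix n → Bool
matchesPattern {k = k} r c P M =
  allᵇ (λ i → allᵇ (λ j → not (M (r i) (c j) xor P i j)) (allFin k)) (allFin k)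

KUniform : ∀ {n} → ℕ → List (Matrix n) → Set
KUniform {n} k L =
  (r c : Fin k → Fin n) → Injective _≡_ _≡_ r → Injective _≡_ _≡_ c →
  (P : Fin k → Fin k → Bool) →
  count (matchesPattern r c P) L * 2 ^ (k * k) ≡ length L

{-# OPTIONS --safe #-}
module Submission where

-- With G an m×n matrix over GF(2), m about √n, any k columns of which are linearly independent, the
-- matrix Gᵀ X G is k-uniform for uniform X: both k-row and k-column restrictions of G have dual
-- vectors, and adding hᵢ h'ⱼᵀ to X flips exactly one entry of the chosen k×k submatrix. If every
-- column of G is a sum of 12 unit vectors, then Gᵀ X G has a three-layer circuit with 12n + m² + 12n
-- wires. Such a G with k of order n^(1/4) exists by the first moment method: a dependency among s
-- columns is a sequence of 12s points in which each point occurs an even number of times, and there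
-- are at most (12s·m)^(6s) such sequences out of m^(12s), which beats the n^s choices of columns.

open import Algebra.Bundles using (CommutativeSemiring; CommutativeRing)
import Algebra.Properties.CommutativeSemigroup as CommutativeSemigroupProperties
open import Data.Bool as Bool using (Bool; true; false; _xor_; _∧_; not; if_then_else_)
open import Data.Fin using (Fin; zero; suc; toℕ; fromℕ<; combine; remQuot; _↑ˡ_; _↑ʳ_)
open import Data.List using (List; []; _∷_; _++_; map; foldr; length; allFin; filterᵇ; cartesianProduct; cartesianProductWith)
open import Data.List.Properties using (map-tabulate; length-tabulate; length-++; length-map; length-filter)
open import Data.Nat using (ℕ; zero; suc; _^_; _≤_; _<_; z≤n; s≤s; NonZero; >-nonZero)
open import Function using (_∘_; id)
open import Level using (0ℓ)
open import Relation.Binary.PropositionalEquality as ≡ using (_≡_; _≢_)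
import Relation.Binary.Reasoning.Setoid as SetoidReasoning

-- The middle layer may need a wire for each of the m² entries of X, which limits m to about √n. The
-- n columns of G then cannot all be independent, and independence of every k of them takes its
-- place. Columns are drawn as tuples of positions with repetitions allowed, so s random columns
-- laid end to end form a uniform sequence of points and a dependency becomes a parity condition on
-- that sequence. For d = 2e positions per column, the mean number of dependencies on t ≤ k columns
-- is at most (n (2ek / m)^e)^t. With m about n^(1/2) and k about n^(1/4) the base has order n^(1 -
-- e/4). It has to stay below 1/(k+1), so e must be at least 5; the choice e = 6 leaves a factor of
-- order k for the constants.

-- Finite sums over lists, shared by counting in ℕ and linear algebra over GF(2)

module ListSum (S : CommutativeSemiring 0ℓ 0ℓ) where
  open CommutativeSemiring S hiding (zero)
  open SetoidReasoning setoid
  open CommutativeSemigroupProperties +-commutativeSemigroup using (interchange)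

  ∑ : {A : Set} → List A → (A → Carrier) → Carrier
  ∑ xs F = foldr (λ x s → F x + s) 0# xs

  ∑-cong : {A : Set} (xs : List A) {F G : A → Carrier} → (∀ x → F x ≈ G x) → ∑ xs F ≈ ∑ xs G
  ∑-cong []       eq = refl
  ∑-cong (x ∷ xs) eq = +-cong (eq x) (∑-cong xs eq)

  ∑-zero : {A : Set} (xs : List A) → ∑ xs (λ _ → 0#) ≈ 0#
  ∑-zero []       = refl
  ∑-zero (x ∷ xs) = trans (+-identityˡ _) (∑-zero xs)

  ∑-++ : {A : Set} (xs ys : List A) (F : A → Carrier) → ∑ (xs ++ ys) F ≈ ∑ xs F + ∑ ys F
  ∑-++ []       ys F = sym (+-identityˡ _)
  ∑-++ (x ∷ xs) ys F = trans (+-congˡ (∑-++ xs ys F)) (sym (+-assoc _ _ _))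

  ∑-map : {A B : Set} (h : A → B) (xs : List A) (F : B → Carrier) → ∑ (map h xs) F ≈ ∑ xs (F ∘ h)
  ∑-map h []       F = refl
  ∑-map h (x ∷ xs) F = +-congˡ (∑-map h xs F)

  ∑-distrib-+ : {A : Set} (xs : List A) (F G : A → Carrier) →
                ∑ xs (λ x → F x + G x) ≈ ∑ xs F + ∑ xs G
  ∑-distrib-+ []       F G = sym (+-identityˡ _)
  ∑-distrib-+ (x ∷ xs) F G = trans (+-congˡ (∑-distrib-+ xs F G)) (interchange _ _ _ _)

  *-distribˡ-∑ : {A : Set} (c : Carrier) (xs : List A) (F : A → Carrier) →
                 c * ∑ xs F ≈ ∑ xs (λ x → c * F x)
  *-distribˡ-∑ c []       F = zeroʳ c
  *-distribˡ-∑ c (x ∷ xs) F = trans (distribˡ c _ _) (+-congˡ (*-distribˡ-∑ c xs F))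

  *-distribʳ-∑ : {A : Set} (c : Carrier) (xs : List A) (F : A → Carrier) →
                 ∑ xs F * c ≈ ∑ xs (λ x → F x * c)
  *-distribʳ-∑ c []       F = zeroˡ c
  *-distribʳ-∑ c (x ∷ xs) F = trans (distribʳ c _ _) (+-congˡ (*-distribʳ-∑ c xs F))

  ∑-comm : {A B : Set} (xs : List A) (ys : List B) (F : A → B → Carrier) →
           ∑ xs (λ x → ∑ ys (F x)) ≈ ∑ ys (λ y → ∑ xs (λ x → F x y))
  ∑-comm []       ys F = sym (∑-zero ys)
  ∑-comm (x ∷ xs) ys F = trans (+-congˡ (∑-comm xs ys F)) (sym (∑-distrib-+ ys _ _))

  ∑-product : {A B C : Set} (g : A → B → C) (xs : List A) (ys : List B) (F : C → Carrier) →
              ∑ (cartesianProductWith g xs ys) F ≈ ∑ xs (λ x → ∑ ys (λ y → F (g x y)))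
  ∑-product g []       ys F = refl
  ∑-product g (x ∷ xs) ys F = trans (∑-++ (map (g x) ys) _ F) (+-cong (∑-map (g x) ys F) (∑-product g xs ys F))

  ∑-filter : {A : Set} (p : A → Bool) (xs : List A) (F : A → Carrier) →
             ∑ (filterᵇ p xs) F ≈ ∑ xs (λ x → if p x then F x else 0#)
  ∑-filter p []       F = refl
  ∑-filter p (x ∷ xs) F with p x
  ... | true  = +-congˡ (∑-filter p xs F)
  ... | false = trans (∑-filter p xs F) (sym (+-identityˡ _))

  ∑-allFin-suc : ∀ {n} (F : Fin (suc n) → Carrier) →
                 ∑ (allFin (suc n)) F ≈ F zero + ∑ (allFin n) (F ∘ suc)
  ∑-allFin-suc {n} F = +-congˡ (trans (reflexive (≡.cong (λ xs → ∑ xs F) (≡.sym (map-tabulate id suc))))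
                                      (∑-map suc (allFin n) F))

  ∑-select : ∀ {n} (i : Fin n) (F : Fin n → Carrier) → (∀ j → j ≢ i → F j ≈ 0#) → ∑ (allFin n) F ≈ F i
  ∑-select {suc n} zero F z = begin
    ∑ (allFin (suc n)) F             ≈⟨ ∑-allFin-suc F ⟩
    F zero + ∑ (allFin n) (F ∘ suc)    ≈⟨ +-congˡ (∑-cong (allFin n) (λ j → z (suc j) λ ())) ⟩
    F zero + ∑ (allFin n) (λ _ → 0#)   ≈⟨ +-congˡ (∑-zero (allFin n)) ⟩
    F zero + 0#                        ≈⟨ +-identityʳ _ ⟩
    F zero                             ∎
  ∑-select {suc n} (suc i) F z = begin
    ∑ (allFin (suc n)) F             ≈⟨ ∑-allFin-suc F ⟩
    F zero + ∑ (allFin n) (F ∘ suc)    ≈⟨ +-cong (z zero λ ()) (∑-select i (F ∘ suc) (λ j j≢i → z (suc j) λ { ≡.refl → j≢i ≡.refl })) ⟩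
    0# + F (suc i)                     ≈⟨ +-identityˡ _ ⟩
    F (suc i)                          ∎

open import Defs
open import Data.Bool.Properties using (xor-∧-commutativeRing; xor-assoc; xor-comm; xor-identityʳ; not-¬; ¬-not; not-involutive; not-distribˡ-xor; ∧-assoc; ∧-comm; ∧-zeroʳ; ∧-identityʳ; ∧-distribʳ-xor; ∧-distribˡ-xor)
open import Data.Empty using (⊥-elim)
open import Data.Fin.Properties using (_≟_; any?; toℕ<n; toℕ-fromℕ<; remQuot-combine)
open import Data.List.Membership.Propositional using (_∈_)
open import Data.List.Membership.Propositional.Properties using (∈-allFin)
open import Data.List.Relation.Unary.All using (All; []; _∷_; universal)
open import Data.List.Relation.Unary.All.Properties using (map⁺)
open import Data.List.Relation.Unary.AllPairs using (_∷_; [])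
open import Data.List.Relation.Unary.Any using (here; there)
open import Data.List.Relation.Unary.Unique.Propositional using (Unique)
open import Data.List.Relation.Unary.Unique.Propositional.Properties using (allFin⁺; cartesianProduct⁺)
open import Data.Nat using (_+_; _*_)
open import Data.Nat.Properties hiding (_≟_)
open import Data.Nat.Tactic.RingSolver using (solve-∀)
open import Data.Product using (Σ; _×_; _,_; ∃; proj₁; proj₂; swap; uncurry)
open import Data.Sum using (_⊎_; inj₁; inj₂; map₂)
open import Data.Vec using (Vec; []; _∷_; lookup; updateAt; replicate; zipWith; tabulate)
open import Data.Vec.Properties using (updateAt-updateAt-local; updateAt-id; updateAt-commutes; lookup∘updateAt; lookup∘updateAt′; lookup-replicate; lookup-zipWith; lookup∘tabulate)
open import Function.Definitions using (Injective)
open ≡ using (refl; sym; trans; cong; cong₂; subst; module ≡-Reasoning)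
open import Relation.Nullary using (yes; no; does)
open import Relation.Nullary.Decidable using (dec-true; dec-false)

private variable
  d k m n : ℕ

open ListSum +-*-commutativeSemiring
open ListSum (CommutativeRing.commutativeSemiring xor-∧-commutativeRing) using ()
  renaming ( ∑ to ⨁; ∑-cong to ⨁-cong; ∑-distrib-+ to ⨁-distrib-xor
           ; *-distribˡ-∑ to ∧-distribˡ-⨁; *-distribʳ-∑ to ∧-distribʳ-⨁; ∑-comm to ⨁-comm
           ; ∑-product to ⨁-product; ∑-filter to ⨁-filter; ∑-select to ⨁-select; ∑-map to ⨁-map
           ; ∑-allFin-suc to ⨁-allFin-suc)

-- Counting in ℕ and enumeration of vectors

length-allFin : ∀ n → length (allFin n) ≡ n
length-allFin n = length-tabulate {n = n} id

∑-mono : {A : Set} (xs : List A) {F G : A → ℕ} → (∀ x → F x ≤ G x) → ∑ xs F ≤ ∑ xs G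
∑-mono []       le = z≤n
∑-mono (x ∷ xs) le = +-mono-≤ (le x) (∑-mono xs le)

∑-const : {A : Set} (xs : List A) (c : ℕ) → ∑ xs (λ _ → c) ≡ length xs * c
∑-const []       c = refl
∑-const (x ∷ xs) c = cong (c +_) (∑-const xs c)

-- The first moment principle. A nonzero head contributes at least 1, so dropping it preserves the
-- strict inequality.
∑<length⇒∃0 : {A : Set} (xs : List A) (F : A → ℕ) → ∑ xs F < length xs → ∃ λ x → F x ≡ 0
∑<length⇒∃0 (x ∷ xs) F lt with F x in eq
... | zero  = x , eq
... | suc q = ∑<length⇒∃0 xs F (≤-trans (s≤s (m≤n+m _ q)) (≤-pred lt))

length-cartesianProductWith : {A B C : Set} (g : A → B → C) (xs : List A) (ys : List B) →
                              length (cartesianProductWith g xs ys) ≡ length xs * length ys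
length-cartesianProductWith g []       ys = refl
length-cartesianProductWith g (x ∷ xs) ys = trans (length-++ (map (g x) ys))
  (cong₂ _+_ (length-map (g x) ys) (length-cartesianProductWith g xs ys))

-- Built as an iterated product so that `∑-product` splits a sum over vectors one coordinate at a
-- time.
allVec : {A : Set} → List A → (n : ℕ) → List (Vec A n)
allVec xs zero    = [] ∷ []
allVec xs (suc n) = cartesianProductWith _∷_ xs (allVec xs n)

length-allVec : {A : Set} (xs : List A) (n : ℕ) → length (allVec xs n) ≡ length xs ^ n
length-allVec xs zero    = refl
length-allVec xs (suc n) = trans (length-cartesianProductWith _∷_ xs (allVec xs n)) (cong (length xs *_) (length-allVec xs n))

-- Even sequences of points

toggle : Fin m → Vec Bool m → Vec Bool m
toggle v w = updateAt w v not

toggle-involutive : (v : Fin m) (w : Vec Bool m) → toggle v (toggle v w) ≡ w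
toggle-involutive v w = trans (updateAt-updateAt-local v w (not-involutive _)) (updateAt-id v w)

toggle-comm : (v x : Fin m) (w : Vec Bool m) → v ≢ x → toggle v (toggle x w) ≡ toggle x (toggle v w)
toggle-comm v x w v≢x = updateAt-commutes v x v≢x w

lookup-toggle : (v u : Fin m) (w : Vec Bool m) → lookup (toggle v w) u ≡ does (v ≟ u) xor lookup w u
lookup-toggle v u w with v ≟ u
... | yes refl = lookup∘updateAt v w
... | no v≢u   = lookup∘updateAt′ u v (v≢u ∘ sym) w

zeros : Vec Bool m
zeros = replicate _ false

-- Valued in ℕ rather than `Bool`: it is the base case of the counts `walks` and `dependencies`.
isZero : Vec Bool m → ℕ
isZero []          = 1
isZero (true ∷ w)  = 0
isZero (false ∷ w) = isZero w

isZero-zeros : ∀ m → isZero (zeros {m}) ≡ 1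
isZero-zeros zero    = refl
isZero-zeros (suc m) = isZero-zeros m

isZero-true : (w : Vec Bool m) (v : Fin m) → lookup w v ≡ true → isZero w ≡ 0
isZero-true (true  ∷ w) zero    eq = refl
isZero-true (true  ∷ w) (suc v) eq = refl
isZero-true (false ∷ w) (suc v) eq = isZero-true w v eq

-- The number of sequences in (Fin m)^l whose unit vectors add up to w over GF(2).
walks : ℕ → Vec Bool m → ℕ
walks zero    w = isZero w
walks (suc l) w = ∑ (allFin _) (λ v → walks l (toggle v w))

-- Some position carries v: remove it, distinguishing whether it is the first one.
walks-odd : ∀ l (v : Fin m) (w : Vec Bool m) → lookup w v ≡ false →
            walks (suc l) (toggle v w) ≤ suc l * walks l w
walks-odd {m} l v w wv = begin
  ∑ (allFin m) (λ x → walks l (toggle x (toggle v w)))   ≤⟨ ∑-mono (allFin m) termwise ⟩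
  ∑ (allFin m) (λ x → hit x + miss l x)                  ≡⟨ ∑-distrib-+ (allFin m) hit (miss l) ⟩
  ∑ (allFin m) hit + ∑ (allFin m) (miss l)               ≡⟨ cong₂ _+_ ∑-hit (∑-miss l) ⟩
  walks l w + l * walks l w                              ∎
  where
  open ≤-Reasoning
  hit : Fin m → ℕ
  hit x = if does (x ≟ v) then walks l w else 0
  -- Defined at x = v as well; this overcount turns the sum into a full walk count.
  miss : ℕ → Fin m → ℕ
  miss zero    x = 0
  miss (suc l) x = suc l * walks l (toggle x w)
  ∑-hit : ∑ (allFin m) hit ≡ walks l w
  ∑-hit = trans (∑-select v hit λ j j≢v → cong (λ b → if b then walks l w else 0) (dec-false (j ≟ v) j≢v))
                (cong (λ b → if b then walks l w else 0) (dec-true (v ≟ v) refl))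
  ∑-miss : ∀ l → ∑ (allFin m) (miss l) ≡ l * walks l w
  ∑-miss zero    = ∑-zero (allFin m)
  ∑-miss (suc l) = sym (*-distribˡ-∑ (suc l) (allFin m) _)
  -- A first point x other than v leaves coordinate v set, so v must occur among the l remaining
  -- points. This is impossible for l = 0 and is the lemma itself, one step shorter, otherwise.
  bound : ∀ l x → x ≢ v → walks l (toggle x (toggle v w)) ≤ miss l x
  bound zero x x≢v = ≤-reflexive (isZero-true (toggle x (toggle v w)) v (trans (lookup∘updateAt′ v x (x≢v ∘ sym) (toggle v w))
                       (trans (lookup∘updateAt v {not} w) (cong not wv))))
  bound (suc l) x x≢v = begin
    walks (suc l) (toggle x (toggle v w))   ≡⟨ cong (walks (suc l)) (toggle-comm x v w x≢v) ⟩
    walks (suc l) (toggle v (toggle x w))   ≤⟨ walks-odd l v (toggle x w) (trans (lookup∘updateAt′ v x (x≢v ∘ sym) w) wv) ⟩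
    suc l * walks l (toggle x w)            ∎
  termwise : ∀ x → walks l (toggle x (toggle v w)) ≤ hit x + miss l x
  termwise x with x ≟ v
  ... | yes refl = ≤-trans (≤-reflexive (cong (walks l) (toggle-involutive v w))) (m≤m+n _ _)
  ... | no x≢v   = bound l x x≢v

-- The first point of an even sequence occurs again; removing both occurrences leaves an even
-- sequence, which gives m^h (2h-1)!! in total. Replacing every odd factor by one D yields a pure
-- power, as needed for the cancellation of t-th powers in `totalDependencies-small`.
walks-even : ∀ D h → 2 * h ≤ D → walks (2 * h) (zeros {m}) ≤ (D * m) ^ h
walks-even {m} D zero    le = ≤-reflexive (isZero-zeros m)
walks-even {m} D (suc h) le = begin
  walks (2 * suc h) (zeros {m})                                 ≡⟨ cong (λ l → walks l (zeros {m})) 2h+2 ⟩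
  ∑ (allFin m) (λ v → walks (suc (2 * h)) (toggle v zeros))     ≤⟨ ∑-mono (allFin m) (λ v → walks-odd (2 * h) v zeros (lookup-zeros v)) ⟩
  ∑ (allFin m) (λ _ → suc (2 * h) * walks (2 * h) zeros)        ≡⟨ ∑-const (allFin m) _ ⟩
  length (allFin m) * (suc (2 * h) * walks (2 * h) zeros)       ≡⟨ cong (_* (suc (2 * h) * walks {m} (2 * h) zeros)) (length-allFin m) ⟩
  m * (suc (2 * h) * walks (2 * h) zeros)                       ≤⟨ *-monoʳ-≤ m (*-mono-≤ odd≤D (walks-even D h (≤-trans (n≤1+n _) odd≤D))) ⟩
  m * (D * (D * m) ^ h)                                         ≡⟨ rearrange m D _ ⟩
  (D * m) ^ suc h                                               ∎
  where
  open ≤-Reasoning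
  2h+2 : 2 * suc h ≡ suc (suc (2 * h))
  2h+2 = *-suc 2 h
  odd≤D : suc (2 * h) ≤ D
  odd≤D = ≤-trans (n≤1+n _) (subst (_≤ D) 2h+2 le)
  lookup-zeros : (v : Fin m) → lookup zeros v ≡ false
  lookup-zeros v = lookup-replicate v false
  rearrange : ∀ m D z → m * (D * z) ≡ (D * m) * z
  rearrange = solve-∀

-- Sparse matrices with independent columns

term≤∑ : {A : Set} {xs : List A} (F : A → ℕ) {x : A} → x ∈ xs → F x ≤ ∑ xs F
term≤∑ F (here refl) = m≤m+n _ _
term≤∑ F (there x∈)  = ≤-trans (term≤∑ F x∈) (m≤n+m _ _)

-- A column is stored as the positions of its d unit vectors; repeated positions cancel in pairs.
addColumn : Vec (Fin m) d → Vec Bool m → Vec Bool m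
addColumn []      w = w
addColumn (v ∷ c) w = addColumn c (toggle v w)

syndrome : Vec (Vec (Fin m) d) n → Vec Bool n → Vec Bool m → Vec Bool m
syndrome []      []          w = w
syndrome (c ∷ f) (true ∷ S)  w = syndrome f S (addColumn c w)
syndrome (c ∷ f) (false ∷ S) w = syndrome f S w

weight : Vec Bool n → ℕ
weight []          = 0
weight (true ∷ S)  = suc (weight S)
weight (false ∷ S) = weight S

-- The number of S of weight s with syndrome f S w = 0.
dependencies : Vec (Vec (Fin m) d) n → ℕ → Vec Bool m → ℕ
dependencies []      zero    w = isZero w
dependencies []      (suc s) w = 0
dependencies (c ∷ f) zero    w = dependencies f zero w
dependencies (c ∷ f) (suc s) w = dependencies f (suc s) w + dependencies f s (addColumn c w)

-- S is itself one of the sets counted on the right, so a vanishing count rules it out as a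
-- dependency.
isZero-syndrome≤dependencies : (f : Vec (Vec (Fin m) d) n) (S : Vec Bool n) (w : Vec Bool m) →
                               isZero (syndrome f S w) ≤ dependencies f (weight S) w
isZero-syndrome≤dependencies []      []          w = ≤-refl
isZero-syndrome≤dependencies (c ∷ f) (true ∷ S)  w =
  ≤-trans (isZero-syndrome≤dependencies f S (addColumn c w)) (m≤n+m _ _)
isZero-syndrome≤dependencies (c ∷ f) (false ∷ S) w with weight S | isZero-syndrome≤dependencies f S w
... | zero  | le = le
... | suc s | le = ≤-trans le (m≤m+n _ _)

columns : ∀ m d → List (Vec (Fin m) d)
columns m d = allVec (allFin m) d

-- Choosing a column amounts to choosing the first d points of a longer walk.
∑-walks-addColumn : ∀ d l (w : Vec Bool m) → ∑ (columns m d) (λ c → walks l (addColumn c w)) ≡ walks (d + l) w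
∑-walks-addColumn         zero    l w = +-identityʳ _
∑-walks-addColumn {m = m} (suc d) l w =
  trans (∑-product _∷_ (allFin m) (columns m d) _)
        (∑-cong (allFin m) (λ v → ∑-walks-addColumn d l (toggle v w)))

totalDependencies : ∀ m d n → ℕ → Vec Bool m → ℕ
totalDependencies m d n s w = ∑ (allVec (columns m d) n) (λ f → dependencies f s w)

-- Both sides are scaled by M ^ s so that no subtraction n ∸ s occurs; n ^ s stands in for n choose s.
totalDependencies-bound : ∀ d n s (w : Vec Bool m) → let M = length (columns m d) in
  totalDependencies m d n s w * M ^ s ≤ n ^ s * (M ^ n * walks (s * d) w)
totalDependencies-bound d zero zero    w = ≤-reflexive (rearrange (isZero w))
  where
  rearrange : ∀ x → (x + 0) * 1 ≡ 1 * (1 * x)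
  rearrange = solve-∀
totalDependencies-bound d zero (suc s) w = z≤n
totalDependencies-bound {m} d (suc n) zero w = begin
  totalDependencies m d (suc n) 0 w * 1               ≡⟨ cong (_* 1) (∑-product _∷_ (columns m d) (allVec (columns m d) n) _) ⟩
  ∑ (columns m d) (λ _ → T) * 1                       ≡⟨ cong (_* 1) (∑-const (columns m d) T) ⟩
  M * T * 1                                           ≡⟨ *-assoc M T 1 ⟩
  M * (T * 1)                                         ≤⟨ *-monoʳ-≤ M (totalDependencies-bound d n 0 w) ⟩
  M * (1 * (M ^ n * isZero w))                        ≡⟨ rearrange M (M ^ n) (isZero w) ⟩
  1 * (M ^ suc n * isZero w)                          ∎
  where
  open ≤-Reasoning
  M = length (columns m d)
  T = totalDependencies m d n 0 w
  rearrange : ∀ x y z → x * (1 * (y * z)) ≡ 1 * (x * y * z)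
  rearrange = solve-∀
totalDependencies-bound {m} d (suc n) (suc s) w = begin
  totalDependencies m d (suc n) (suc s) w * M ^ suc s
    ≡⟨ cong (_* M ^ suc s) expand ⟩
  (M * T + ∑ cols U) * (M * M ^ s)
    ≡⟨ rearrange₁ M T (∑ cols U) (M ^ s) ⟩
  M * (T * M ^ suc s) + M * (∑ cols U * M ^ s)
    ≡⟨ cong (λ z → M * (T * M ^ suc s) + M * z) (*-distribʳ-∑ (M ^ s) cols U) ⟩
  M * (T * M ^ suc s) + M * ∑ cols (λ c → U c * M ^ s)
    ≤⟨ +-mono-≤ (*-monoʳ-≤ M (totalDependencies-bound d n (suc s) w))
                (*-monoʳ-≤ M (∑-mono cols (λ c → totalDependencies-bound d n s (addColumn c w)))) ⟩
  M * (n ^ suc s * (M ^ n * W)) + M * ∑ cols (λ c → n ^ s * (M ^ n * walks (s * d) (addColumn c w)))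
    ≡⟨ cong (λ z → M * (n ^ suc s * (M ^ n * W)) + M * z) factor ⟩
  M * (n ^ suc s * (M ^ n * W)) + M * (n ^ s * (M ^ n * W))
    ≡⟨ rearrange₂ M n (n ^ s) (M ^ n) W ⟩
  suc n * n ^ s * (M ^ suc n * W)
    -- Pascal's rule with powers for binomials: n^(s+1) + n^s = (n+1) n^s, which is at most
    -- (n+1)^(s+1).
    ≤⟨ *-monoˡ-≤ (M ^ suc n * W) (*-monoʳ-≤ (suc n) (^-monoˡ-≤ s (n≤1+n n))) ⟩
  suc n ^ suc s * (M ^ suc n * W) ∎
  where
  open ≤-Reasoning
  cols = columns m d
  M = length cols
  T = totalDependencies m d n (suc s) w
  U : Vec (Fin m) d → ℕ
  U c = totalDependencies m d n s (addColumn c w)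
  W = walks (d + s * d) w
  -- The first column is either outside the dependency, and then free (factor M), or inside it, and
  -- then it shifts the target w.
  expand : totalDependencies m d (suc n) (suc s) w ≡ M * T + ∑ cols U
  expand = trans (∑-product _∷_ cols (allVec cols n) _)
    (trans (∑-cong cols (λ c → ∑-distrib-+ (allVec cols n) _ _))
    (trans (∑-distrib-+ cols (λ _ → T) U) (cong (_+ ∑ cols U) (∑-const cols T))))
  factor : ∑ cols (λ c → n ^ s * (M ^ n * walks (s * d) (addColumn c w))) ≡ n ^ s * (M ^ n * W)
  factor = sym (trans (cong (λ z → n ^ s * (M ^ n * z)) (sym (∑-walks-addColumn d (s * d) w)))
    (trans (cong (n ^ s *_) (*-distribˡ-∑ (M ^ n) cols _)) (*-distribˡ-∑ (n ^ s) cols _)))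
  rearrange₁ : ∀ M T X Y → (M * T + X) * (M * Y) ≡ M * (T * (M * Y)) + M * (X * Y)
  rearrange₁ = solve-∀
  rearrange₂ : ∀ M n p q W → M * (n * p * (q * W)) + M * (p * (q * W)) ≡ suc n * p * (M * q * W)
  rearrange₂ = solve-∀

length-columns : ∀ m d → length (columns m d) ≡ m ^ d
length-columns m d = trans (length-allVec (allFin m) d) (cong (_^ d) (length-allFin m))

^-distribʳ-* : ∀ a b s → (a * b) ^ s ≡ a ^ s * b ^ s
^-distribʳ-* a b zero    = refl
^-distribʳ-* a b (suc s) = trans (cong (a * b *_) (^-distribʳ-* a b s)) (interchange a b (a ^ s) (b ^ s))
  where
  interchange : ∀ a b x y → a * b * (x * y) ≡ (a * x) * (b * y)
  interchange = solve-∀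

-- With Q = m^e, R = (2ek)^e and M = Q², the two counting bounds give T ≤ M^n (nR/Q)^t. The
-- hypothesis reads (k+1) n R ≤ Q, so the mean T / M^n is at most (k+1)^(-t), hence at most 1/(k+1):
-- small enough to be summed over k sizes. Division is replaced by cancelling (nR)^t and Q^t.
totalDependencies-small : ∀ e k m n s .{{_ : NonZero e}} .{{_ : NonZero m}} .{{_ : NonZero n}} →
  n * suc k * (2 * (e * k)) ^ e ≤ m ^ e → suc s ≤ k →
  totalDependencies m (2 * e) n (suc s) zeros * suc k ≤ length (columns m (2 * e)) ^ n
totalDependencies-small e k m n s large s<k =
  ≤-trans (*-monoʳ-≤ T (m≤m*n (suc k) (suc k ^ s) {{m^n≢0 (suc k) s}}))
    (*-cancelʳ-≤ _ _ ((n * R) ^ t) {{m^n≢0 (n * R) t {{m*n≢0 n R}}}}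
      (*-cancelʳ-≤ _ _ (Q ^ t) {{m^n≢0 Q t {{Q≢0}}}} (begin
    T * suc k ^ t * (n * R) ^ t * Q ^ t    ≡⟨ cong (_* Q ^ t) (*-assoc T (suc k ^ t) _) ⟩
    T * (suc k ^ t * (n * R) ^ t) * Q ^ t  ≡⟨ cong (λ z → T * z * Q ^ t) (sym (^-distribʳ-* (suc k) (n * R) t)) ⟩
    T * (suc k * (n * R)) ^ t * Q ^ t      ≤⟨ *-monoˡ-≤ (Q ^ t) (*-monoʳ-≤ T (^-monoˡ-≤ t
                                                (≤-trans (≤-reflexive (rearrange₁ (suc k) n R)) large))) ⟩
    T * Q ^ t * Q ^ t                      ≡⟨ *-assoc T (Q ^ t) (Q ^ t) ⟩
    T * (Q ^ t * Q ^ t)                    ≡⟨ cong (T *_) (sym (^-distribʳ-* Q Q t)) ⟩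
    T * (Q * Q) ^ t                        ≡⟨ cong (λ z → T * z ^ t) (sym M≡Q²) ⟩
    T * M ^ t                              ≤⟨ totalDependencies-bound (2 * e) n t zeros ⟩
    n ^ t * (M ^ n * walks (t * (2 * e)) (zeros {m}))
                                           ≡⟨ cong (λ l → n ^ t * (M ^ n * walks l (zeros {m}))) (rearrange₂ t e) ⟩
    n ^ t * (M ^ n * walks (2 * (e * t)) (zeros {m}))
                                           ≤⟨ *-monoʳ-≤ (n ^ t) (*-monoʳ-≤ (M ^ n) (walks-even D (e * t) (*-monoʳ-≤ 2 (*-monoʳ-≤ e s<k)))) ⟩
    n ^ t * (M ^ n * (D * m) ^ (e * t))    ≡⟨ cong (λ z → n ^ t * (M ^ n * z)) (trans (sym (^-*-assoc (D * m) e t))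
                                                (trans (cong (_^ t) (^-distribʳ-* D m e)) (^-distribʳ-* R Q t))) ⟩
    n ^ t * (M ^ n * (R ^ t * Q ^ t))      ≡⟨ rearrange₃ (n ^ t) (M ^ n) (R ^ t) (Q ^ t) ⟩
    M ^ n * (n ^ t * R ^ t) * Q ^ t        ≡⟨ cong (λ z → M ^ n * z * Q ^ t) (sym (^-distribʳ-* n R t)) ⟩
    M ^ n * (n * R) ^ t * Q ^ t            ∎)))
  where
  open ≤-Reasoning
  t = suc s
  T = totalDependencies m (2 * e) n t zeros
  M = length (columns m (2 * e))
  -- One D serves all sizes: t ≤ k columns have 2et ≤ 2ek points.
  D = 2 * (e * k)
  Q = m ^ e
  R = D ^ e
  Q≢0 : NonZero Q
  Q≢0 = m^n≢0 m e
  instance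
    k≢0 : NonZero k
    k≢0 = >-nonZero (≤-trans (s≤s z≤n) s<k)
    R≢0 : NonZero R
    R≢0 = m^n≢0 D e {{m*n≢0 2 (e * k) {{_}} {{m*n≢0 e k}}}}
  M≡Q² : M ≡ Q * Q
  M≡Q² = trans (length-columns m (2 * e)) (trans (cong (m ^_) (cong (e +_) (+-identityʳ e))) (^-distribˡ-+-* m e e))
  rearrange₁ : ∀ a n r → a * (n * r) ≡ n * a * r
  rearrange₁ = solve-∀
  rearrange₂ : ∀ t e → t * (2 * e) ≡ 2 * (e * t)
  rearrange₂ = solve-∀
  rearrange₃ : ∀ a b c q → a * (b * (c * q)) ≡ b * (a * c) * q
  rearrange₃ = solve-∀

-- Equivalently, f is the parity-check matrix of a code of minimum distance greater than k.
Independent : ℕ → Vec (Vec (Fin m) d) n → Set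
Independent {n = n} k f = (S : Vec Bool n) → weight S ≤ k → syndrome f S zeros ≡ zeros → weight S ≡ 0

-- Each of the k sizes contributes at most 1/(k+1) to the mean of `bad`, which is therefore below 1.
∃-independent : ∀ e k m n .{{_ : NonZero e}} .{{_ : NonZero m}} .{{_ : NonZero n}} →
  n * suc k * (2 * (e * k)) ^ e ≤ m ^ e → ∃ λ (f : Vec (Vec (Fin m) (2 * e)) n) → Independent k f
∃-independent e k m n large =
  let f , eq = ∑<length⇒∃0 fs bad (*-cancelʳ-< (suc k) _ _ (≤-trans (s≤s total) room))
  in  f , independent f eq
  where
  open ≤-Reasoning
  fs = allVec (columns m (2 * e)) n
  L = length (columns m (2 * e)) ^ n
  -- Sizes run from 1 to k, whence `suc (toℕ s)`: the empty set always has zero syndrome.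
  bad : Vec (Vec (Fin m) (2 * e)) n → ℕ
  bad f = ∑ (allFin k) (λ s → dependencies f (suc (toℕ s)) zeros)
  length-fs : length fs ≡ L
  length-fs = length-allVec (columns m (2 * e)) n
  L>0 : 0 < L
  L>0 = subst (0 <_) (cong (_^ n) (sym (length-columns m (2 * e)))) (m^n>0 (m ^ (2 * e)) {{m^n≢0 m (2 * e)}} n)
  total : ∑ fs bad * suc k ≤ k * L
  total = begin
    ∑ fs bad * suc k                                                       ≡⟨ cong (_* suc k) (∑-comm fs (allFin k) _) ⟩
    ∑ (allFin k) (λ s → totalDependencies m (2 * e) n (suc (toℕ s)) zeros) * suc k  ≡⟨ *-distribʳ-∑ (suc k) (allFin k) _ ⟩
    ∑ (allFin k) (λ s → totalDependencies m (2 * e) n (suc (toℕ s)) zeros * suc k)  ≤⟨ ∑-mono (allFin k) (λ s → totalDependencies-small e k m n (toℕ s) large (toℕ<n s)) ⟩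
    ∑ (allFin k) (λ _ → L)                                                 ≡⟨ trans (∑-const (allFin k) L) (cong (_* L) (length-allFin k)) ⟩
    k * L                                                                  ∎
  room : k * L < length fs * suc k
  room = begin-strict
    k * L              <⟨ m<n+m (k * L) L>0 ⟩
    L + k * L          ≡⟨ *-comm (suc k) L ⟩
    L * suc k          ≡⟨ cong (_* suc k) (sym length-fs) ⟩
    length fs * suc k  ∎
  independent : ∀ f → bad f ≡ 0 → Independent k f
  independent f eq S S≤k syn with weight S | isZero-syndrome≤dependencies f S zeros
  ... | zero  | _  = refl
  ... | suc s | le = ⊥-elim (n≮0 (begin
    1                                                  ≡⟨ sym (trans (cong isZero syn) (isZero-zeros m)) ⟩
    isZero (syndrome f S zeros)                        ≤⟨ le ⟩
    dependencies f (suc s) zeros                       ≡⟨ cong (λ s → dependencies f (suc s) zeros) (sym (toℕ-fromℕ< S≤k)) ⟩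
    dependencies f (suc (toℕ (fromℕ< S≤k))) zeros      ≤⟨ term≤∑ (λ s → dependencies f (suc (toℕ s)) zeros) (∈-allFin (fromℕ< S≤k)) ⟩
    bad f                                              ≡⟨ eq ⟩
    0                                                  ∎))

-- Duality over GF(2)

dot : (Fin k → Bool) → (Fin k → Bool) → Bool
dot p q = ⨁ (allFin _) (λ i → p i ∧ q i)

dot-xorˡ : (p p' q : Fin k → Bool) → dot (λ i → p i xor p' i) q ≡ dot p q xor dot p' q
dot-xorˡ {k} p p' q = trans (⨁-cong (allFin k) (λ i → ∧-distribʳ-xor (q i) (p i) (p' i))) (⨁-distrib-xor (allFin k) (λ i → p i ∧ q i) (λ i → p' i ∧ q i))

dot-xorʳ : (p q q' : Fin k → Bool) → dot p (λ i → q i xor q' i) ≡ dot p q xor dot p q'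
dot-xorʳ {k} p q q' = trans (⨁-cong (allFin k) (λ i → ∧-distribˡ-xor (p i) (q i) (q' i))) (⨁-distrib-xor (allFin k) (λ i → p i ∧ q i) (λ i → p i ∧ q' i))

dot-unit : (i : Fin k) (q : Fin k → Bool) → dot (λ j → does (j ≟ i)) q ≡ q i
dot-unit i q = trans (⨁-select i _ (λ j j≢i → cong (_∧ q j) (dec-false (j ≟ i) j≢i))) (cong (_∧ q i) (dec-true (i ≟ i) refl))

Solution : (Fin k → Fin m → Bool) → (Fin k → Bool) → Set
Solution {m = m} g b = Σ (Fin m → Bool) λ h → ∀ i → dot (g i) h ≡ b i

-- A combination of the equations that reads 0 = 1: the certificate of unsolvability in the Fredholm
-- alternative.
Obstruction : (Fin k → Fin m → Bool) → (Fin k → Bool) → Set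
Obstruction {k = k} g b = Σ (Fin k → Bool) λ S → (∀ u → dot S (λ i → g i u) ≡ false) × dot S b ≡ true

-- Induction on m: fix the first coordinate of h to be 0 or 1. If both choices are obstructed, then one
-- of the two obstructions or their sum is orthogonal to the first coordinates as well.
alternative : (g : Fin k → Fin m → Bool) (b : Fin k → Bool) → Solution g b ⊎ Obstruction g b
alternative {m = zero} g b with any? (λ i → b i Bool.≟ true)
... | yes (i , bi) = inj₂ ((λ j → does (j ≟ i)) , (λ ()) , trans (dot-unit i b) bi)
... | no none      = inj₁ ((λ ()) , λ i → sym (¬-not (λ bi → none (i , bi))))
alternative {k = k} {m = suc m} g b = combineSides (alternative g' b) (alternative g' b')
  where
  -- `a` collects the coefficients of the first unknown, and `b'` is the right-hand side once that
  -- unknown is set to 1.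
  a b' : Fin k → Bool
  a i  = g i zero
  b' i = b i xor a i
  g' : Fin k → Fin m → Bool
  g' i u = g i (suc u)
  extend : Bool → (Fin m → Bool) → Fin (suc m) → Bool
  extend x h zero    = x
  extend x h (suc u) = h u
  dot-extend : ∀ i x h → dot (g i) (extend x h) ≡ (a i ∧ x) xor dot (g' i) h
  dot-extend i x h = ⨁-allFin-suc (λ u → g i u ∧ extend x h u)
  obstruction : (S : Fin k → Bool) → (∀ u → dot S (λ i → g' i u) ≡ false) → dot S a ≡ false → dot S b ≡ true → Obstruction g b
  obstruction S Sg Sa Sb = S , (λ { zero → Sa ; (suc u) → Sg u }) , Sb
  combineSides : Solution g' b ⊎ Obstruction g' b → Solution g' b' ⊎ Obstruction g' b' → Solution g b ⊎ Obstruction g b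
  combineSides (inj₁ (h , eq)) _ = inj₁ (extend false h , λ i →
    trans (dot-extend i false h) (trans (cong (_xor dot (g' i) h) (∧-zeroʳ (a i))) (eq i)))
  combineSides (inj₂ _) (inj₁ (h , eq)) = inj₁ (extend true h , λ i →
    trans (dot-extend i true h) (trans (cong₂ _xor_ (∧-identityʳ (a i)) (eq i)) (cancel (a i) (b i))))
    where
    cancel : ∀ x y → x xor (y xor x) ≡ y
    cancel false y     = xor-identityʳ y
    cancel true  false = refl
    cancel true  true  = refl
  combineSides (inj₂ (S , Sg , Sb)) (inj₂ (S' , S'g , S'b'))
    with dot S a in Sa | dot S' a in S'a | trans (sym (dot-xorʳ S' b a)) S'b'
  ... | false | _     | _   = inj₂ (obstruction S Sg Sa Sb)
  ... | true  | false | S'b = inj₂ (obstruction S' S'g S'a (trans (sym (xor-identityʳ _)) S'b))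
  -- Here S'·b + S'·a = 1 and S'·a = 1 force S'·b = 0, so S + S' takes the value 1 + 0 on b and 1 +
  -- 1 = 0 on a.
  ... | true  | true  | S'b = inj₂ (obstruction (λ i → S i xor S' i)
          (λ u → trans (dot-xorˡ S S' _) (cong₂ _xor_ (Sg u) (S'g u)))
          (trans (dot-xorˡ S S' a) (cong₂ _xor_ Sa S'a))
          (trans (dot-xorˡ S S' b) (trans (cong (_xor dot S' b) Sb)
            (trans (sym (xor-comm (dot S' b) true)) S'b))))

-- Dual vectors from independent columns

column : Vec (Vec (Fin m) d) n → Fin n → Fin m → Bool
column f j u = ⨁ (allFin _) (λ t → does (lookup (lookup f j) t ≟ u))

lookup-addColumn : (c : Vec (Fin m) d) (w : Vec Bool m) (u : Fin m) →
  lookup (addColumn c w) u ≡ ⨁ (allFin d) (λ t → does (lookup c t ≟ u)) xor lookup w u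
lookup-addColumn []      w u = refl
lookup-addColumn {d = suc d} (v ∷ c) w u = begin
  lookup (addColumn c (toggle v w)) u               ≡⟨ lookup-addColumn c (toggle v w) u ⟩
  rest xor lookup (toggle v w) u                    ≡⟨ cong (rest xor_) (lookup-toggle v u w) ⟩
  rest xor (does (v ≟ u) xor lookup w u)            ≡⟨ sym (xor-assoc rest _ _) ⟩
  (rest xor does (v ≟ u)) xor lookup w u            ≡⟨ cong (_xor lookup w u) (xor-comm rest (does (v ≟ u))) ⟩
  (does (v ≟ u) xor rest) xor lookup w u            ≡⟨ cong (_xor lookup w u) (sym (⨁-allFin-suc (λ t → does (lookup (v ∷ c) t ≟ u)))) ⟩
  ⨁ (allFin (suc d)) (λ t → does (lookup (v ∷ c) t ≟ u)) xor lookup w u ∎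
  where
  open ≡-Reasoning
  rest = ⨁ (allFin d) (λ t → does (lookup c t ≟ u))

-- Passes from the accumulator form, suited to counting, to the matrix-vector product, suited to
-- duality.
lookup-syndrome : (f : Vec (Vec (Fin m) d) n) (S : Vec Bool n) (w : Vec Bool m) (u : Fin m) →
  lookup (syndrome f S w) u ≡ dot (lookup S) (λ j → column f j u) xor lookup w u
lookup-syndrome []      []         w u = refl
lookup-syndrome (c ∷ f) (x ∷ S) w u = trans (step x) (cong (_xor lookup w u)
    (sym (⨁-allFin-suc (λ j → lookup (x ∷ S) j ∧ column (c ∷ f) j u))))
  where
  rest = dot (lookup S) (λ j → column f j u)
  head = column (c ∷ f) zero u
  step : ∀ x → lookup (syndrome (c ∷ f) (x ∷ S) w) u ≡ ((x ∧ head) xor rest) xor lookup w u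
  step false = lookup-syndrome f S w u
  step true  = trans (lookup-syndrome f S (addColumn c w) u)
    (trans (cong (rest xor_) (lookup-addColumn c w u))
    (trans (sym (xor-assoc rest head _)) (cong (_xor lookup w u) (xor-comm rest head))))

weight-zeros : ∀ n → weight (zeros {n}) ≡ 0
weight-zeros zero    = refl
weight-zeros (suc n) = weight-zeros n

weight-toggle : (v : Fin n) (S : Vec Bool n) → weight (toggle v S) ≤ suc (weight S)
weight-toggle zero    (true  ∷ S) = ≤-trans (n≤1+n _) (n≤1+n _)
weight-toggle zero    (false ∷ S) = ≤-refl
weight-toggle (suc v) (true  ∷ S) = s≤s (weight-toggle v S)
weight-toggle (suc v) (false ∷ S) = weight-toggle v S

weight≡0⇒false : (S : Vec Bool n) → weight S ≡ 0 → ∀ j → lookup S j ≡ false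
weight≡0⇒false (false ∷ S) eq zero    = refl
weight≡0⇒false (false ∷ S) eq (suc j) = weight≡0⇒false S eq j

≡zeros : (w : Vec Bool m) → (∀ u → lookup w u ≡ false) → w ≡ zeros
≡zeros []      eq = refl
≡zeros (x ∷ w) eq = cong₂ _∷_ (eq zero) (≡zeros w (eq ∘ suc))

-- Toggling makes this the linear map that sends the i-th unit vector to the (r i)-th;
-- `dot-pushforward` says that it is adjoint to composition with r.
pushforward : (Fin k → Fin n) → (Fin k → Bool) → Vec Bool n
pushforward {k = zero}  r S = zeros
pushforward {k = suc k} r S = if S zero then toggle (r zero) rest else rest
  where rest = pushforward (r ∘ suc) (S ∘ suc)

weight-pushforward : (r : Fin k → Fin n) (S : Fin k → Bool) → weight (pushforward r S) ≤ k
weight-pushforward {k = zero}  {n = n} r S rewrite weight-zeros n = z≤n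
weight-pushforward {k = suc k} r S with S zero
... | true  = ≤-trans (weight-toggle (r zero) (pushforward (r ∘ suc) (S ∘ suc))) (s≤s (weight-pushforward (r ∘ suc) (S ∘ suc)))
... | false = ≤-trans (weight-pushforward (r ∘ suc) (S ∘ suc)) (n≤1+n _)

lookup-pushforward : (r : Fin k → Fin n) (S : Fin k → Bool) (j : Fin n) →
  lookup (pushforward r S) j ≡ dot S (λ i → does (r i ≟ j))
lookup-pushforward {k = zero}  r S j = lookup-replicate j false
lookup-pushforward {k = suc k} r S j = trans (step (S zero)) (sym (⨁-allFin-suc (λ i → S i ∧ does (r i ≟ j))))
  where
  rest = pushforward (r ∘ suc) (S ∘ suc)
  step : ∀ x → lookup (if x then toggle (r zero) rest else rest) j ≡
               (x ∧ does (r zero ≟ j)) xor dot (S ∘ suc) (λ i → does (r (suc i) ≟ j))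
  step true  = trans (lookup-toggle (r zero) j rest) (cong (does (r zero ≟ j) xor_) (lookup-pushforward (r ∘ suc) (S ∘ suc) j))
  step false = lookup-pushforward (r ∘ suc) (S ∘ suc) j

dot-pushforward : (r : Fin k → Fin n) (S : Fin k → Bool) (q : Fin n → Bool) →
  dot (lookup (pushforward r S)) q ≡ dot S (q ∘ r)
dot-pushforward {k = k} {n = n} r S q = begin
  ⨁ (allFin n) (λ j → lookup (pushforward r S) j ∧ q j)
    ≡⟨ ⨁-cong (allFin n) (λ j → trans (cong (_∧ q j) (lookup-pushforward r S j)) (∧-distribʳ-⨁ (q j) (allFin k) (λ i → S i ∧ does (r i ≟ j)))) ⟩
  ⨁ (allFin n) (λ j → ⨁ (allFin k) (λ i → (S i ∧ does (r i ≟ j)) ∧ q j))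
    ≡⟨ ⨁-comm (allFin n) (allFin k) (λ j i → (S i ∧ does (r i ≟ j)) ∧ q j) ⟩
  ⨁ (allFin k) (λ i → ⨁ (allFin n) (λ j → (S i ∧ does (r i ≟ j)) ∧ q j))
    ≡⟨ ⨁-cong (allFin k) (λ i → trans (⨁-select (r i) _ (λ j j≢ri →
         cong (_∧ q j) (trans (cong (S i ∧_) (dec-false (r i ≟ j) (j≢ri ∘ sym))) (∧-zeroʳ (S i)))))
         (cong (_∧ q (r i)) (trans (cong (S i ∧_) (dec-true (r i ≟ r i) refl)) (∧-identityʳ (S i))))) ⟩
  ⨁ (allFin k) (λ i → S i ∧ q (r i)) ∎
  where open ≡-Reasoning

-- A dual system: vectors hᵢ whose product with g j is the Kronecker delta of i and j.
Dual : (Fin k → Fin m → Bool) → Set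
Dual {k = k} g = ∀ (i : Fin k) → Solution g (λ j → does (j ≟ i))

-- An obstruction to hᵢ is a dependency S among the chosen columns with S i = 1. Its pushforward has
-- weight at most k and zero syndrome, so it vanishes; but r is injective, so its value at r i is S
-- i.
independent⇒dual : (f : Vec (Vec (Fin m) d) n) → Independent k f →
  (r : Fin k → Fin n) → Injective _≡_ _≡_ r → Dual (column f ∘ r)
independent⇒dual f ind r inj i with alternative (column f ∘ r) (λ j → does (j ≟ i))
... | inj₁ solution = solution
... | inj₂ (S , Sg , Si) = ⊥-elim (not-¬ Ti≡false Ti≡true)
  where
  T = pushforward r S
  syndrome-T : ∀ u → lookup (syndrome f T zeros) u ≡ false
  syndrome-T u = trans (lookup-syndrome f T zeros u)
    (trans (cong₂ _xor_ (trans (dot-pushforward r S (λ j → column f j u)) (Sg u)) (lookup-replicate u false)) refl)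
  Ti≡false : lookup T (r i) ≡ false
  Ti≡false = weight≡0⇒false T (ind T (weight-pushforward r S) (≡zeros _ syndrome-T)) (r i)
  same : ∀ j → does (r j ≟ r i) ≡ does (j ≟ i)
  same j with j ≟ i
  ... | yes refl = dec-true (r i ≟ r i) refl
  ... | no j≢i   = dec-false (r j ≟ r i) (j≢i ∘ inj)
  Ti≡true : lookup T (r i) ≡ true
  Ti≡true = trans (lookup-pushforward r S (r i)) (trans (⨁-cong (allFin _) (λ j → cong (S j ∧_) (same j))) Si)

-- Uniformity of Gᵀ X G

count-cong : {A : Set} {p q : A → Bool} → (∀ x → p x ≡ q x) → ∀ xs → count p xs ≡ count q xs
count-cong eq []       = refl
count-cong eq (x ∷ xs) rewrite eq x | count-cong eq xs = refl

count-∑ : {A : Set} (p : A → Bool) (xs : List A) → count p xs ≡ ∑ xs (λ x → if p x then 1 else 0)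
count-∑ p []       = refl
count-∑ p (x ∷ xs) with p x
... | true  = cong suc (count-∑ p xs)
... | false = count-∑ p xs

count-map : {A B : Set} (h : A → B) (p : B → Bool) (xs : List A) → count p (map h xs) ≡ count (p ∘ h) xs
count-map h p []       = refl
count-map h p (x ∷ xs) rewrite count-map h p xs = refl

count-true : {A : Set} (xs : List A) → count (λ _ → true) xs ≡ length xs
count-true []       = refl
count-true (x ∷ xs) = cong suc (count-true xs)

count-split : {A : Set} (p q : A → Bool) (xs : List A) →
  count (λ x → p x ∧ q x) xs + count (λ x → not (p x) ∧ q x) xs ≡ count q xs
count-split p q []       = refl
count-split p q (x ∷ xs) with p x | q x | count-split p q xs
... | true  | true  | eq = cong suc eq
... | true  | false | eq = eq
... | false | true  | eq = trans (+-suc _ _) (cong suc eq)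
... | false | false | eq = eq

-- The map τ i preserves counts and exchanges q i with its negation while leaving the other events
-- alone. So exactly half of the elements that satisfy the remaining events satisfy q i too.
count-independent : {I A : Set} (xs : List A) (q : I → A → Bool) (τ : I → A → A) →
  (∀ i p → count (p ∘ τ i) xs ≡ count p xs) →
  (∀ i x → q i (τ i x) ≡ not (q i x)) →
  (∀ i j → i ≢ j → ∀ x → q j (τ i x) ≡ q j x) →
  ∀ {is} → Unique is → count (λ x → allᵇ (λ i → q i x) is) xs * 2 ^ length is ≡ length xs
count-independent xs q τ preserve flips fixes []                         = trans (cong (_* 1) (count-true xs)) (*-identityʳ _)
count-independent xs q τ preserve flips fixes (_∷_ {i} {is} i∉is unique) = begin
  c * (2 * 2 ^ length is)        ≡⟨ rearrange c (2 ^ length is) ⟩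
  (c + c) * 2 ^ length is        ≡⟨ cong (λ z → (c + z) * 2 ^ length is) (trans (sym (preserve i _)) (count-cong flipped xs)) ⟩
  (c + c') * 2 ^ length is       ≡⟨ cong (_* 2 ^ length is) (count-split (q i) R xs) ⟩
  count R xs * 2 ^ length is     ≡⟨ count-independent xs q τ preserve flips fixes unique ⟩
  length xs                      ∎
  where
  open ≡-Reasoning
  R = λ x → allᵇ (λ j → q j x) is
  c  = count (λ x → q i x ∧ R x) xs
  c' = count (λ x → not (q i x) ∧ R x) xs
  rearrange : ∀ c z → c * (2 * z) ≡ (c + c) * z
  rearrange = solve-∀
  fixed : ∀ {js} → All (i ≢_) js → ∀ x → allᵇ (λ j → q j (τ i x)) js ≡ allᵇ (λ j → q j x) js
  fixed []           x = refl
  fixed (i≢j ∷ i∉js) x = cong₂ _∧_ (fixes i _ i≢j x) (fixed i∉js x)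
  flipped : ∀ x → q i (τ i x) ∧ R (τ i x) ≡ not (q i x) ∧ R x
  flipped x = cong₂ _∧_ (flips i x) (fixed i∉is x)

cube : ∀ n → List (Vec Bool n)
cube = allVec (false ∷ true ∷ [])

-- Translation by y permutes the cube: each coordinate has its two bits swapped or fixed.
∑-cube-xor : (y : Vec Bool n) (F : Vec Bool n → ℕ) → ∑ (cube n) (F ∘ zipWith _xor_ y) ≡ ∑ (cube n) F
∑-cube-xor []          F = refl
∑-cube-xor {n = suc n} (x ∷ y) F = begin
  ∑ (cube (suc n)) (F ∘ zipWith _xor_ (x ∷ y))   ≡⟨ ∑-product _∷_ bits (cube n) _ ⟩
  ∑ bits (λ b → ∑ (cube n) (λ z → F ((x xor b) ∷ zipWith _xor_ y z)))  ≡⟨ ∑-cong bits (λ b → ∑-cube-xor y (λ z → F ((x xor b) ∷ z))) ⟩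
  ∑ bits (G ∘ (x xor_))                          ≡⟨ ∑-bits-xor x ⟩
  ∑ bits G                                       ≡⟨ sym (∑-product _∷_ bits (cube n) F) ⟩
  ∑ (cube (suc n)) F                             ∎
  where
  open ≡-Reasoning
  bits = false ∷ true ∷ []
  G : Bool → ℕ
  G b = ∑ (cube n) (λ z → F (b ∷ z))
  ∑-bits-xor : ∀ x → ∑ bits (G ∘ (x xor_)) ≡ ∑ bits G
  ∑-bits-xor false = refl
  ∑-bits-xor true  = exchange (G true) (G false)
    where
    exchange : ∀ a b → a + (b + 0) ≡ b + (a + 0)
    exchange = solve-∀

count-cube-xor : (y : Vec Bool n) (p : Vec Bool n → Bool) → count (p ∘ zipWith _xor_ y) (cube n) ≡ count p (cube n)
count-cube-xor {n = n} y p = trans (count-∑ (p ∘ zipWith _xor_ y) (cube n)) (trans (∑-cube-xor y (λ z → if p z then 1 else 0)) (sym (count-∑ p (cube n))))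

-- X is kept as a flat vector, so that a uniform X is `cube (m * m)` and matrix addition is
-- `zipWith _xor_`.
entry : Vec Bool (m * m) → Fin m → Fin m → Bool
entry x u v = lookup x (combine u v)

outer : (Fin m → Bool) → (Fin m → Bool) → Vec Bool (m * m)
outer {m = m} h h' = tabulate (λ i → uncurry (λ u v → h u ∧ h' v) (remQuot m i))

entry-outer : (h h' : Fin m → Bool) (u v : Fin m) → entry (outer h h') u v ≡ h u ∧ h' v
entry-outer h h' u v = trans (lookup∘tabulate _ (combine u v)) (cong (uncurry (λ u v → h u ∧ h' v)) (remQuot-combine u v))

bilinear : (Fin m → Fin m → Bool) → (Fin m → Bool) → (Fin m → Bool) → Bool
bilinear X p q = dot p (λ u → dot (X u) q)

-- pᵀ X q is linear in X, and pᵀ (h h'ᵀ) q factors as (p·h)(h'·q). For dual vectors h and h' the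
-- factors become Kronecker deltas.
bilinear-outer-xor : (h h' : Fin m → Bool) (x : Vec Bool (m * m)) (p q : Fin m → Bool) →
  bilinear (entry (zipWith _xor_ (outer h h') x)) p q ≡ (dot p h ∧ dot h' q) xor bilinear (entry x) p q
bilinear-outer-xor {m = m} h h' x p q = begin
  dot p (λ u → dot (entry (zipWith _xor_ (outer h h') x) u) q)
    ≡⟨ ⨁-cong (allFin m) (λ u → cong (p u ∧_) (row u)) ⟩
  dot p (λ u → (h u ∧ dot h' q) xor dot (entry x u) q)
    ≡⟨ dot-xorʳ p _ _ ⟩
  dot p (λ u → h u ∧ dot h' q) xor bilinear (entry x) p q
    ≡⟨ cong (_xor bilinear (entry x) p q) (trans (⨁-cong (allFin m) (λ u → sym (∧-assoc (p u) (h u) _)))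
                                                 (sym (∧-distribʳ-⨁ (dot h' q) (allFin m) (λ u → p u ∧ h u)))) ⟩
  (dot p h ∧ dot h' q) xor bilinear (entry x) p q ∎
  where
  open ≡-Reasoning
  row : ∀ u → dot (entry (zipWith _xor_ (outer h h') x) u) q ≡ (h u ∧ dot h' q) xor dot (entry x u) q
  row u = trans (⨁-cong (allFin m) (λ v → cong (_∧ q v)
      (trans (lookup-zipWith _xor_ (combine u v) (outer h h') x) (cong (_xor entry x u v) (entry-outer h h' u v)))))
    (trans (dot-xorˡ (λ v → h u ∧ h' v) (entry x u) q)
    (cong (_xor dot (entry x u) q) (trans (⨁-cong (allFin m) (λ v → ∧-assoc (h u) (h' v) (q v)))
                                          (sym (∧-distribˡ-⨁ (h u) (allFin m) (λ v → h' v ∧ q v))))))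

allᵇ-++ : {A : Set} (p : A → Bool) (xs ys : List A) → allᵇ p (xs ++ ys) ≡ allᵇ p xs ∧ allᵇ p ys
allᵇ-++ p []       ys = refl
allᵇ-++ p (x ∷ xs) ys = trans (cong (p x ∧_) (allᵇ-++ p xs ys)) (sym (∧-assoc (p x) _ _))

allᵇ-map : {A B : Set} (h : A → B) (p : B → Bool) (xs : List A) → allᵇ p (map h xs) ≡ allᵇ (p ∘ h) xs
allᵇ-map h p []       = refl
allᵇ-map h p (x ∷ xs) = cong (p (h x) ∧_) (allᵇ-map h p xs)

allᵇ-cartesianProduct : {A B : Set} (p : A × B → Bool) (xs : List A) (ys : List B) →
  allᵇ p (cartesianProduct xs ys) ≡ allᵇ (λ x → allᵇ (λ y → p (x , y)) ys) xs
allᵇ-cartesianProduct p []       ys = refl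
allᵇ-cartesianProduct p (x ∷ xs) ys = trans (allᵇ-++ p (map (x ,_) ys) _)
  (cong₂ _∧_ (allᵇ-map (x ,_) p ys) (allᵇ-cartesianProduct p xs ys))

-- This is Gᵀ X G, where g i is the i-th column of G.
sandwich : (Fin n → Fin m → Bool) → Vec Bool (m * m) → Matrix n
sandwich g x i j = bilinear (entry x) (g i) (g j)

dot-comm : (p q : Fin k → Bool) → dot p q ≡ dot q p
dot-comm p q = ⨁-cong (allFin _) (λ i → ∧-comm (p i) (q i))

-- Matching P is a conjunction of k² events indexed by pairs, and `count-independent` halves the
-- count once per pair.
sandwich-uniform : (g : Fin n → Fin m → Bool) →
  ((r : Fin k → Fin n) → Injective _≡_ _≡_ r → Dual (g ∘ r)) →
  KUniform k (map (sandwich g) (cube (m * m)))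
sandwich-uniform {n = n} {m = m} {k = k} g dual r c r-inj c-inj P = begin
  count (matchesPattern r c P) (map (sandwich g) xs) * 2 ^ (k * k)
    ≡⟨ cong₂ (λ z e → z * 2 ^ e) (trans (count-map (sandwich g) (matchesPattern r c P) xs)
         (count-cong (λ x → sym (allᵇ-cartesianProduct (λ ij → q ij x) (allFin k) (allFin k))) xs)) (sym length-pairs) ⟩
  count (λ x → allᵇ (λ ij → q ij x) pairs) xs * 2 ^ length pairs
    ≡⟨ count-independent xs q τ (λ ij → count-cube-xor (shift ij)) flips fixes
         (cartesianProduct⁺ (allFin⁺ k) (allFin⁺ k)) ⟩
  length xs
    ≡⟨ sym (length-map (sandwich g) xs) ⟩
  length (map (sandwich g) xs) ∎
  where
  open ≡-Reasoning
  xs = cube (m * m)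
  pairs = cartesianProduct (allFin k) (allFin k)
  length-pairs : length pairs ≡ k * k
  length-pairs = trans (length-cartesianProductWith _,_ (allFin k) (allFin k)) (cong₂ _*_ (length-allFin k) (length-allFin k))
  q : Fin k × Fin k → Vec Bool (m * m) → Bool
  q (i , j) x = not (sandwich g x (r i) (c j) xor P i j)
  shift : Fin k × Fin k → Vec Bool (m * m)
  shift (i , j) = outer (proj₁ (dual r r-inj i)) (proj₁ (dual c c-inj j))
  τ : Fin k × Fin k → Vec Bool (m * m) → Vec Bool (m * m)
  τ ij = zipWith _xor_ (shift ij)
  -- The shift for (i , j) adds to the entry at (i' , j') the product of two deltas, which is 1 only
  -- when the pairs agree.
  q-shift : ∀ i j i' j' x → q (i' , j') (τ (i , j) x) ≡
            not (((does (i' ≟ i) ∧ does (j' ≟ j)) xor sandwich g x (r i') (c j')) xor P i' j')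
  q-shift i j i' j' x = cong (λ z → not (z xor P i' j'))
    (trans (bilinear-outer-xor h h' x (g (r i')) (g (c j')))
    (cong (_xor sandwich g x (r i') (c j')) (cong₂ _∧_ (proj₂ (dual r r-inj i) i')
      (trans (dot-comm h' (g (c j'))) (proj₂ (dual c c-inj j) j')))))
    where
    h  = proj₁ (dual r r-inj i)
    h' = proj₁ (dual c c-inj j)
  flips : ∀ ij x → q ij (τ ij x) ≡ not (q ij x)
  flips (i , j) x = trans (q-shift i j i j x) (trans (cong (λ z → not ((z xor sandwich g x (r i) (c j)) xor P i j))
      (cong₂ _∧_ (dec-true (i ≟ i) refl) (dec-true (j ≟ j) refl)))
    (cong not (sym (not-distribˡ-xor (sandwich g x (r i) (c j)) (P i j)))))
  fixes : ∀ ij ij' → ij ≢ ij' → ∀ x → q ij' (τ ij x) ≡ q ij' x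
  fixes (i , j) (i' , j') ne x = trans (q-shift i j i' j' x)
      (cong (λ z → not ((z xor sandwich g x (r i') (c j')) xor P i' j')) off)
    where
    off : does (i' ≟ i) ∧ does (j' ≟ j) ≡ false
    off with i' ≟ i | j' ≟ j
    ... | yes refl | yes refl = ⊥-elim (ne refl)
    ... | yes _    | no _     = refl
    ... | no _     | _        = refl

-- Circuits from products of sparse matrices

private variable
  a b M : ℕ

length≡∑1 : {A : Set} (xs : List A) → length xs ≡ ∑ xs (λ _ → 1)
length≡∑1 []       = refl
length≡∑1 (x ∷ xs) = cong suc (length≡∑1 xs)

-- One layer: all b new gates read from `gs` alone, so references to old gates are shifted past the
-- new gates lying in between. Adding gate `zero` last makes `u ↑ˡ M` the index of new gate u.
addGates : Gates n M → (Fin b → List (Node n M)) → Gates n (b + M)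
addGates {b = zero}  gs cs = gs
addGates {b = suc b} gs cs = addGates gs (cs ∘ suc) ▷ map (map₂ (b ↑ʳ_)) (cs zero)

gateValue-old : (gs : Gates n M) (cs : Fin b → List (Node n M)) (i : Fin M) →
                gateValue (addGates gs cs) (b ↑ʳ i) ≡ gateValue gs i
gateValue-old {b = zero}  gs cs i = refl
gateValue-old {b = suc b} gs cs i = gateValue-old gs (cs ∘ suc) i

sumForms-childValues : (gs : Gates n M) (h : Node n a → Node n M) (cs : List (Node n a)) (x : Fin n) →
  sumForms (childValues gs (map h cs)) x ≡ ⨁ cs (λ c → nodeValue gs (h c) x)
sumForms-childValues gs h []       x = refl
sumForms-childValues gs h (c ∷ cs) x = cong (nodeValue gs (h c) x xor_) (sumForms-childValues gs h cs x)

gateValue-new : (gs : Gates n M) (cs : Fin b → List (Node n M)) (u : Fin b) (x : Fin n) →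
                gateValue (addGates gs cs) (u ↑ˡ M) x ≡ ⨁ (cs u) (λ c → nodeValue gs c x)
gateValue-new {b = suc b} gs cs zero x =
  trans (sumForms-childValues (addGates gs (cs ∘ suc)) (map₂ (b ↑ʳ_)) (cs zero) x) (⨁-cong (cs zero) old)
  where
  old : ∀ c → nodeValue (addGates gs (cs ∘ suc)) (map₂ (b ↑ʳ_) c) x ≡ nodeValue gs c x
  old (inj₁ j) = refl
  old (inj₂ i) = cong (λ f → f x) (gateValue-old gs (cs ∘ suc) i)
gateValue-new {b = suc b} gs cs (suc u) x = gateValue-new gs (cs ∘ suc) u x

wires-addGates : (gs : Gates n M) (cs : Fin b → List (Node n M)) →
                 wires (addGates gs cs) ≡ wires gs + ∑ (allFin b) (length ∘ cs)
wires-addGates {b = zero}  gs cs = sym (+-identityʳ _)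
wires-addGates {b = suc b} gs cs = begin
  wires (addGates gs (cs ∘ suc)) + length (map (map₂ (b ↑ʳ_)) (cs zero))
    ≡⟨ cong₂ _+_ (wires-addGates gs (cs ∘ suc)) (length-map _ (cs zero)) ⟩
  wires gs + ∑ (allFin b) (length ∘ cs ∘ suc) + length (cs zero)
    ≡⟨ +-assoc (wires gs) _ _ ⟩
  wires gs + (∑ (allFin b) (length ∘ cs ∘ suc) + length (cs zero))
    ≡⟨ cong (wires gs +_) (trans (+-comm (∑ (allFin b) (length ∘ cs ∘ suc)) (length (cs zero)))
         (sym (∑-allFin-suc (length ∘ cs)))) ⟩
  wires gs + ∑ (allFin (suc b)) (length ∘ cs) ∎
  where open ≡-Reasoning

-- A list of positions stands for the 0/1 matrix that is their sum over GF(2), and so for a layer with one wire per position.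
apply : List (Fin b × Fin a) → (Fin a → Bool) → Fin b → Bool
apply E v u = ⨁ E (λ e → does (proj₁ e ≟ u) ∧ v (proj₂ e))

apply-cong : (E : List (Fin b × Fin a)) {v w : Fin a → Bool} → (∀ j → v j ≡ w j) → ∀ u → apply E v u ≡ apply E w u
apply-cong E eq u = ⨁-cong E (λ e → cong (does (proj₁ e ≟ u) ∧_) (eq (proj₂ e)))

-- A repeated position stays as a parallel wire, so the wire count is exactly the length of E.
children : (Fin a → Node n M) → List (Fin b × Fin a) → Fin b → List (Node n M)
children src E u = map (src ∘ proj₂) (filterᵇ (λ e → does (proj₁ e ≟ u)) E)

if-false≡∧ : ∀ x y → (if x then y else false) ≡ x ∧ y
if-false≡∧ false y = refl
if-false≡∧ true  y = refl

layer-value : (gs : Gates n M) (src : Fin a → Node n M) (E : List (Fin b × Fin a)) (u : Fin b) (x : Fin n) →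
  gateValue (addGates gs (children src E)) (u ↑ˡ M) x ≡ apply E (λ j → nodeValue gs (src j) x) u
layer-value gs src E u x = begin
  gateValue (addGates gs (children src E)) (u ↑ˡ _) x
    ≡⟨ gateValue-new gs (children src E) u x ⟩
  ⨁ (children src E u) (λ c → nodeValue gs c x)
    ≡⟨ ⨁-map (src ∘ proj₂) (filterᵇ (λ e → does (proj₁ e ≟ u)) E) (λ c → nodeValue gs c x) ⟩
  ⨁ (filterᵇ (λ e → does (proj₁ e ≟ u)) E) (λ e → nodeValue gs (src (proj₂ e)) x)
    ≡⟨ ⨁-filter _ E _ ⟩
  ⨁ E (λ e → if does (proj₁ e ≟ u) then nodeValue gs (src (proj₂ e)) x else false)
    ≡⟨ ⨁-cong E (λ e → if-false≡∧ (does (proj₁ e ≟ u)) _) ⟩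
  apply E (λ j → nodeValue gs (src j) x) u ∎
  where open ≡-Reasoning

-- Double counting: each position has exactly one target gate.
layer-wires : (gs : Gates n M) (src : Fin a → Node n M) (E : List (Fin b × Fin a)) →
  wires (addGates gs (children src E)) ≡ wires gs + length E
layer-wires {b = b} gs src E = trans (wires-addGates gs (children src E)) (cong (wires gs +_) (begin
  ∑ (allFin b) (λ u → length (children src E u))
    ≡⟨ ∑-cong (allFin b) (λ u → trans (length-map _ (filterᵇ (λ e → does (proj₁ e ≟ u)) E))
         (trans (length≡∑1 (filterᵇ (λ e → does (proj₁ e ≟ u)) E)) (∑-filter _ E _))) ⟩
  ∑ (allFin b) (λ u → ∑ E (λ e → if does (proj₁ e ≟ u) then 1 else 0))
    ≡⟨ ∑-comm (allFin b) E (λ u e → if does (proj₁ e ≟ u) then 1 else 0) ⟩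
  ∑ E (λ e → ∑ (allFin b) (λ u → if does (proj₁ e ≟ u) then 1 else 0))
    ≡⟨ ∑-cong E (λ e → one (proj₁ e)) ⟩
  ∑ E (λ _ → 1)
    ≡⟨ sym (length≡∑1 E) ⟩
  length E ∎))
  where
  open ≡-Reasoning
  one : ∀ u' → ∑ (allFin b) (λ u → if does (u' ≟ u) then 1 else 0) ≡ 1
  one u' = trans (∑-select u' (λ u → if does (u' ≟ u) then 1 else 0)
                    (λ u u≢u' → cong (λ t → if t then 1 else 0) (dec-false (u' ≟ u) (u≢u' ∘ sym))))
                 (cong (λ t → if t then 1 else 0) (dec-true (u' ≟ u') refl))

-- For a fixed variable x, its coefficients at the nodes of a layer form a vector on which the next
-- layer acts as its matrix. At the inputs this is the unit vector of x, so column x of the product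
-- appears at the outputs.
apply³-complexity : (E₃ : List (Fin n × Fin b)) (E₂ : List (Fin b × Fin a)) (E₁ : List (Fin a × Fin n)) (A : Matrix n) →
  (∀ i x → apply E₃ (apply E₂ (apply E₁ (λ j → does (j ≟ x)))) i ≡ A i x) →
  XorComplexity≤ A (length E₁ + length E₂ + length E₃)
apply³-complexity {n} {b} {a} E₃ E₂ E₁ A eq =
  record { numGates = n + (b + (a + 0)) ; gates = gs₃ ; output = λ i → inj₂ (i ↑ˡ (b + (a + 0))) } ,
  computes ,
  ≤-reflexive (trans (layer-wires gs₂ _ E₃) (cong (_+ length E₃)
    (trans (layer-wires gs₁ _ E₂) (cong (_+ length E₂) (layer-wires {n} [] inj₁ E₁)))))
  where
  gs₁ : Gates n (a + 0)
  gs₁ = addGates [] (children inj₁ E₁)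
  gs₂ : Gates n (b + (a + 0))
  gs₂ = addGates gs₁ (children (λ u → inj₂ (u ↑ˡ 0)) E₂)
  gs₃ : Gates n (n + (b + (a + 0)))
  gs₃ = addGates gs₂ (children (λ u → inj₂ (u ↑ˡ (a + 0))) E₃)
  computes : ∀ i x → gateValue gs₃ (i ↑ˡ (b + (a + 0))) x ≡ A i x
  computes i x = trans (layer-value gs₂ _ E₃ i x)
    (trans (apply-cong E₃ (λ u → trans (layer-value gs₁ _ E₂ u x)
      (apply-cong E₂ (λ v → layer-value [] inj₁ E₁ v x) u)) i) (eq i x))

-- The three layers of Gᵀ X G

incidences : Vec (Vec (Fin m) d) n → List (Fin m × Fin n)
incidences {d = d} {n = n} f = map (λ (j , t) → lookup (lookup f j) t , j) (cartesianProduct (allFin n) (allFin d))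

length-incidences : (f : Vec (Vec (Fin m) d) n) → length (incidences f) ≡ n * d
length-incidences {d = d} {n = n} f = trans (length-map _ (cartesianProduct (allFin n) (allFin d)))
  (trans (length-cartesianProductWith _,_ (allFin n) (allFin d)) (cong₂ _*_ (length-allFin n) (length-allFin d)))

⨁-incidences : (f : Vec (Vec (Fin m) d) n) (F : Fin m × Fin n → Bool) →
  ⨁ (incidences f) F ≡ ⨁ (allFin n) (λ j → ⨁ (allFin d) (λ t → F (lookup (lookup f j) t , j)))
⨁-incidences {d = d} {n = n} f F = trans (⨁-map _ (cartesianProduct (allFin n) (allFin d)) F)
  (⨁-product _,_ (allFin n) (allFin d) (λ (j , t) → F (lookup (lookup f j) t , j)))

apply-incidences : (f : Vec (Vec (Fin m) d) n) (x : Fin n) (u : Fin m) →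
  apply (incidences f) (λ j → does (j ≟ x)) u ≡ column f x u
apply-incidences {d = d} {n = n} f x u = begin
  apply (incidences f) (λ j → does (j ≟ x)) u
    ≡⟨ ⨁-incidences f (λ e → does (proj₁ e ≟ u) ∧ does (proj₂ e ≟ x)) ⟩
  ⨁ (allFin n) (λ j → ⨁ (allFin d) (λ t → does (lookup (lookup f j) t ≟ u) ∧ does (j ≟ x)))
    ≡⟨ ⨁-cong (allFin n) (λ j → trans (sym (∧-distribʳ-⨁ (does (j ≟ x)) (allFin d) (λ t → does (lookup (lookup f j) t ≟ u)))) (∧-comm (column f j u) _)) ⟩
  dot (λ j → does (j ≟ x)) (λ j → column f j u)
    ≡⟨ dot-unit x _ ⟩
  column f x u ∎
  where open ≡-Reasoning

apply-transposed-incidences : (f : Vec (Vec (Fin m) d) n) (w : Fin m → Bool) (i : Fin n) →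
  apply (map swap (incidences f)) w i ≡ dot (column f i) w
apply-transposed-incidences {m = m} {d = d} {n = n} f w i = begin
  apply (map swap (incidences f)) w i
    ≡⟨ ⨁-map swap (incidences f) (λ e → does (proj₁ e ≟ i) ∧ w (proj₂ e)) ⟩
  ⨁ (incidences f) (λ e → does (proj₂ e ≟ i) ∧ w (proj₁ e))
    ≡⟨ ⨁-incidences f (λ e → does (proj₂ e ≟ i) ∧ w (proj₁ e)) ⟩
  ⨁ (allFin n) (λ j → ⨁ (allFin d) (λ t → does (j ≟ i) ∧ w (lookup (lookup f j) t)))
    ≡⟨ ⨁-cong (allFin n) (λ j → sym (∧-distribˡ-⨁ (does (j ≟ i)) (allFin d) _)) ⟩
  dot (λ j → does (j ≟ i)) (λ j → ⨁ (allFin d) (λ t → w (lookup (lookup f j) t)))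
    ≡⟨ dot-unit i _ ⟩
  ⨁ (allFin d) (λ t → w (lookup (lookup f i) t))
    -- Writing each value of w as a sum over all u against an indicator allows the sums to be
    -- exchanged, which reassembles `column`.
    ≡⟨ ⨁-cong (allFin d) (λ t → sym (at (lookup (lookup f i) t))) ⟩
  ⨁ (allFin d) (λ t → ⨁ (allFin m) (λ u → does (lookup (lookup f i) t ≟ u) ∧ w u))
    ≡⟨ ⨁-comm (allFin d) (allFin m) (λ t u → does (lookup (lookup f i) t ≟ u) ∧ w u) ⟩
  ⨁ (allFin m) (λ u → ⨁ (allFin d) (λ t → does (lookup (lookup f i) t ≟ u) ∧ w u))
    ≡⟨ ⨁-cong (allFin m) (λ u → sym (∧-distribʳ-⨁ (w u) (allFin d) (λ t → does (lookup (lookup f i) t ≟ u)))) ⟩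
  dot (column f i) w ∎
  where
  open ≡-Reasoning
  at : ∀ v → ⨁ (allFin m) (λ u → does (v ≟ u) ∧ w u) ≡ w v
  at v = trans (⨁-select v (λ u → does (v ≟ u) ∧ w u) (λ u u≢v → cong (_∧ w u) (dec-false (v ≟ u) (u≢v ∘ sym))))
               (cong (_∧ w v) (dec-true (v ≟ v) refl))

support : (Fin m → Fin m → Bool) → List (Fin m × Fin m)
support {m} X = filterᵇ (uncurry X) (cartesianProduct (allFin m) (allFin m))

length-support : (X : Fin m → Fin m → Bool) → length (support X) ≤ m * m
length-support {m} X = ≤-trans (length-filter _ (cartesianProduct (allFin m) (allFin m)))
  (≤-reflexive (trans (length-cartesianProductWith _,_ (allFin m) (allFin m)) (cong₂ _*_ (length-allFin m) (length-allFin m))))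

apply-support : (X : Fin m → Fin m → Bool) (w : Fin m → Bool) (u : Fin m) → apply (support X) w u ≡ dot (X u) w
apply-support {m} X w u = begin
  apply (support X) w u
    ≡⟨ ⨁-filter (uncurry X) (cartesianProduct (allFin m) (allFin m)) _ ⟩
  ⨁ (cartesianProduct (allFin m) (allFin m)) (λ (u' , v) → if X u' v then does (u' ≟ u) ∧ w v else false)
    ≡⟨ ⨁-product _,_ (allFin m) (allFin m) (λ (u' , v) → if X u' v then does (u' ≟ u) ∧ w v else false) ⟩
  ⨁ (allFin m) (λ u' → ⨁ (allFin m) (λ v → if X u' v then does (u' ≟ u) ∧ w v else false))
    ≡⟨ ⨁-cong (allFin m) (λ u' → trans (⨁-cong (allFin m) (λ v → pull (X u' v) (does (u' ≟ u)) (w v)))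
         (sym (∧-distribˡ-⨁ (does (u' ≟ u)) (allFin m) (λ v → X u' v ∧ w v)))) ⟩
  dot (λ u' → does (u' ≟ u)) (λ u' → dot (X u') w)
    ≡⟨ dot-unit u _ ⟩
  dot (X u) w ∎
  where
  open ≡-Reasoning
  pull : ∀ x y z → (if x then y ∧ z else false) ≡ y ∧ (x ∧ z)
  pull false y z = sym (∧-zeroʳ y)
  pull true  y z = refl

sandwich-complexity : (f : Vec (Vec (Fin m) d) n) (x : Vec Bool (m * m)) →
  XorComplexity≤ (sandwich (column f) x) (n * d + m * m + n * d)
sandwich-complexity {m = m} {d = d} {n = n} f x =
  let Γ , computes , size≤ = apply³-complexity (map swap E) (support (entry x)) E (sandwich (column f) x) eq
  in  Γ , computes , ≤-trans size≤ (+-mono-≤ (+-mono-≤ (≤-reflexive (length-incidences f)) (length-support {m} (entry x)))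
        (≤-reflexive (trans (length-map swap E) (length-incidences f))))
  where
  E = incidences f
  eq : ∀ i j → apply (map swap E) (apply (support (entry x)) (apply E (λ j' → does (j' ≟ j)))) i ≡ sandwich (column f) x i j
  eq i j = trans (apply-transposed-incidences f _ i) (⨁-cong (allFin m) (λ u → cong (column f i u ∧_)
    (trans (apply-cong (support (entry x)) (apply-incidences f j) u) (apply-support (entry x) (column f j) u))))

-- Choice of parameters

-- From n to n + 1 the value t rises by at most one, since n + 1 ≤ φ (t + 1) < φ (t + 2).
floor : (φ : ℕ → ℕ) → φ 0 ≡ 0 → (∀ t → φ t < φ (suc t)) → ∀ n → ∃ λ t → φ t ≤ n × n < φ (suc t)
floor φ φ0 inc zero    = 0 , ≤-reflexive φ0 , subst (_< φ 1) φ0 (inc 0)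
floor φ φ0 inc (suc n) with floor φ φ0 inc n
... | t , φt≤n , n<φt+1 with φ (suc t) ≤? suc n
...   | yes le = suc t , le , ≤-<-trans n<φt+1 (inc (suc t))
...   | no nle = t , m≤n⇒m≤1+n φt≤n , ≰⇒> nle

-- This is m² for m = (12 t)², where 12 t = 2 e t with e = 6 is the length in points of a dependency
-- on t columns. Inverting it picks the largest k with m² ≤ n.
threshold : ℕ → ℕ
threshold t = (12 * t) ^ 4

threshold-mono-< : ∀ {s t} → s < t → threshold s < threshold t
threshold-mono-< s<t = ^-monoˡ-< 4 (*-monoʳ-< 12 s<t)

threshold-mono-≤ : ∀ {s t} → s ≤ t → threshold s ≤ threshold t
threshold-mono-≤ s≤t = ^-monoˡ-≤ 4 (*-monoʳ-≤ 12 s≤t)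

module Parameters (k n : ℕ) (24≤k : 24 ≤ k) (lower : threshold k ≤ n) (upper : n < threshold (suc k)) where
  open ≤-Reasoning
  base = 12 * k

  k≥1 : 1 ≤ k
  k≥1 = ≤-trans (s≤s z≤n) 24≤k

  instance
    k≢0 : NonZero k
    k≢0 = >-nonZero k≥1
    base≢0 : NonZero base
    base≢0 = m*n≢0 12 k
    n≢0 : NonZero n
    n≢0 = >-nonZero (≤-trans (m^n>0 base 4) lower)
    base*base≢0 : NonZero (base * base)
    base*base≢0 = m*n≢0 base base

  suc-k≤2k : suc k ≤ 2 * k
  suc-k≤2k = ≤-trans (+-monoˡ-≤ k k≥1) (≤-reflexive (cong (k +_) (sym (+-identityʳ k))))

  n≤[24k]^4 : n ≤ (24 * k) ^ 4
  n≤[24k]^4 = begin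
    n                    ≤⟨ <⇒≤ upper ⟩
    threshold (suc k)    ≤⟨ threshold-mono-≤ suc-k≤2k ⟩
    (12 * (2 * k)) ^ 4   ≡⟨ cong (_^ 4) (sym (*-assoc 12 2 k)) ⟩
    (24 * k) ^ 4         ∎

  k≤n : k ≤ n
  k≤n = begin
    k          ≤⟨ m≤n*m k 12 ⟩
    base       ≤⟨ m≤m*n base (base ^ 3) {{m^n≢0 base 3}} ⟩
    base ^ 4   ≤⟨ lower ⟩
    n          ∎

  -- The exponent c = 1/8 instead of 1/4 absorbs the constant in n ≤ (24 k)^4, as soon as k ≥ 24.
  n≤k^8 : n ^ 1 ≤ k ^ 8
  n≤k^8 = begin
    n ^ 1           ≡⟨ ^-identityʳ n ⟩
    n               ≤⟨ n≤[24k]^4 ⟩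
    (24 * k) ^ 4    ≤⟨ ^-monoˡ-≤ 4 (*-monoˡ-≤ k 24≤k) ⟩
    (k * k) ^ 4     ≡⟨ ^-distribʳ-* k k 4 ⟩
    k ^ 4 * k ^ 4   ≡⟨ sym (^-distribˡ-+-* k 4 4) ⟩
    k ^ 8           ∎

  -- For e = 6 the factor (2ek)^e is `base ^ 6`. Once it cancels, n (k + 1), of order k^5, is
  -- compared with `base ^ 6`, of order k^6.
  dense : n * suc k * (2 * (6 * k)) ^ 6 ≤ (base * base) ^ 6
  dense = begin
    n * suc k * (2 * (6 * k)) ^ 6   ≡⟨ cong (λ z → n * suc k * z ^ 6) (sym (*-assoc 2 6 k)) ⟩
    n * suc k * base ^ 6            ≤⟨ *-monoˡ-≤ (base ^ 6) n*suc-k≤base^6 ⟩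
    base ^ 6 * base ^ 6             ≡⟨ sym (^-distribʳ-* base base 6) ⟩
    (base * base) ^ 6               ∎
    where
    n*suc-k≤base^6 : n * suc k ≤ base ^ 6
    n*suc-k≤base^6 = begin
      n * suc k                        ≤⟨ *-mono-≤ n≤[24k]^4 suc-k≤2k ⟩
      (24 * k) ^ 4 * (2 * k)           ≡⟨ cong (λ z → z ^ 4 * (2 * k)) (*-assoc 2 12 k) ⟩
      (2 * base) ^ 4 * (2 * k)         ≡⟨ cong (_* (2 * k)) (^-distribʳ-* 2 base 4) ⟩
      16 * base ^ 4 * (2 * k)          ≡⟨ rearrange (base ^ 4) k ⟩
      base ^ 4 * (32 * k)              ≤⟨ *-monoʳ-≤ (base ^ 4) (≤-trans (*-monoˡ-≤ k (≤-trans (m≤m+n 32 112) (*-monoʳ-≤ 12 (≤-trans (m≤m+n 12 12) 24≤k)))) (m≤n*m (12 * k * k) 12)) ⟩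
      base ^ 4 * (12 * (12 * k * k))   ≡⟨ cong (base ^ 4 *_) (square k) ⟩
      base ^ 4 * base ^ 2              ≡⟨ sym (^-distribˡ-+-* base 4 2) ⟩
      base ^ 6                         ∎
      where
      rearrange : ∀ x k → 16 * x * (2 * k) ≡ x * (32 * k)
      rearrange = solve-∀
      square : ∀ k → 12 * (12 * k * k) ≡ 12 * k * (12 * k * 1)
      square = solve-∀

  -- The middle layer has at most m² = `base ^ 4` wires, which is `threshold k` and so at most n;
  -- hence 25 = 12 + 1 + 12.
  size-bound : n * 12 + (base * base) * (base * base) + n * 12 ≤ 25 * n
  size-bound = begin
    n * 12 + (base * base) * (base * base) + n * 12   ≤⟨ +-monoˡ-≤ (n * 12) (+-monoʳ-≤ (n * 12) (≤-trans (≤-reflexive (square² base)) lower)) ⟩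
    n * 12 + n + n * 12                               ≡⟨ collect n ⟩
    25 * n                                            ∎
    where
    square² : ∀ x → (x * x) * (x * x) ≡ x * (x * (x * (x * 1)))
    square² = solve-∀
    collect : ∀ n → n * 12 + n + n * 12 ≡ 25 * n
    collect = solve-∀

theorem3 : Σ ℕ λ p → Σ ℕ λ q → 0 < p × 0 < q ×
    Σ ℕ λ C → 0 < C ×
    Σ ℕ λ N → (n : ℕ) → N ≤ n →
    Σ (List (Matrix n)) λ L → 0 < length L ×
    Σ ℕ λ k → k ≤ n × n ^ p ≤ k ^ q × KUniform k L ×
    All (λ A → XorComplexity≤ A (C * n)) L
theorem3 = 1 , 8 , s≤s z≤n , s≤s z≤n , 25 , s≤s z≤n , threshold 24 , λ n N≤n →
  let k , lower , upper = floor threshold refl (λ t → threshold-mono-< {t} ≤-refl) n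
      -- If k < 24, then n < `threshold (suc k)` ≤ `threshold 24` ≤ n.
      24≤k = ≮⇒≥ (λ k<24 → <⇒≱ upper (≤-trans (threshold-mono-≤ k<24) N≤n))
      open Parameters k n 24≤k lower upper
      m = base * base
      f , independent = ∃-independent 6 k m n {{_}} {{base*base≢0}} {{n≢0}} dense
      matrices = map (sandwich (column f)) (cube (m * m))
  in matrices ,
     subst (0 <_) (sym (trans (length-map (sandwich (column f)) (cube (m * m))) (length-allVec _ (m * m)))) (m^n>0 2 (m * m)) ,
     k , k≤n , n≤k^8 ,
     sandwich-uniform (column f) (independent⇒dual f independent) ,
     map⁺ (universal (λ x → let Γ , computes , size≤ = sandwich-complexity f x
                            in  Γ , computes , ≤-trans size≤ size-bound) (cube (m * m)))
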